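{- Let $n>0$. The Galois graph of the Hochschild lattice $\mathrm{Hoch}(n)$ is isomorphic (as a directed graph) to the directed graph $(V,E)$ with vertex set $V=\{(1,1),(1,2),\ldots,(1,n),(2,2),(2,3),\ldots,(2,n)\}$ which has an edge $(s,t)\to(s',t')$ if and only if $(s,t)\neq(s',t')$ and either ($s=2$, $s'=1$ and $t=t'$) or ($s=s'=1$ and $t>t'$).
   Context: Hochschild lattice. For $n\geq 1$ let $[n]=\{1,\ldots,n\}$. A triword of length $n$ is a tuple $u=(u_1,\ldots,u_n)$ such that (T1) $u_i\in\{0,1,2\}$ for all $i$; (T2) $u_1\neq 2$; (T3) if $u_i=0$, then $u_j\neq 1$ for all $j>i$. Let $\mathrm{Tri}(n)$ be the set of all triwords of length $n$. The Hochschild lattice is $\mathrm{Hoch}(n)=(\mathrm{Tri}(n),\leq)$ where $\leq$ is the componentwise order. It is known to be a lattice: the join is the componentwise maximum, and the meet is obtained by taking the componentwise minimum and then replacing by $0$ every entry $1$ that has an entry $0$ somewhere to its left. It is also known to be extremal. Extremal lattices and Galois graphs. Let $L$ be a finite lattice. An element is join irreducible if it covers exactly one element, and meet irreducible if it is covered by exactly one element. The length of $L$ is one less than the maximum cardinality of a chain. $L$ is extremal if the number of join-irreducible elements, the number of meet-irreducible elements and the length of $L$ all coincide. If $L$ is extremal of length $k$ and $\hat 0=a_0\lessdot a_1\lessdot\cdots\lessdot a_k=\hat 1$ is a maximal chain of length $k$, then the join-irreducible elements $j_1,\ldots,j_k$ and the meet-irreducible elements $m_1,\ldots,m_k$ can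 be labeled such that for all $s\in[k]$: $j_1\vee j_2\vee\cdots\vee j_s=a_s=m_{s+1}\wedge m_{s+2}\wedge\cdots\wedge m_k$ (an empty meet is $\hat 1$). The Galois graph of $L$ is the directed graph with vertex set $[k]$ in which $s\to t$ is an edge if and only if $s\neq t$ and $j_s\not\leq m_t$. -}

module Defs where

import Algebra.Construct.NaturalChoice.Max as NaturalMax
import Algebra.Construct.NaturalChoice.Min as NaturalMin
open import Data.Empty using (⊥-elim)
open import Data.Fin.Base as Fin using (Fin; zero; suc; toℕ; fromℕ; inject₁)
open import Data.Fin.Patterns using (0F; 1F; 2F)
import Data.Fin.Properties as Fin
open import Data.List.Base using (List; length; foldr; take; drop; tabulate)
open import Data.List.Relation.Unary.AllPairs using (AllPairs)
import Data.List.Relation.Unary.Unique.Setoid as UniqueSetoid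
open import Data.Nat.Base as ℕ using (ℕ; suc; z≤n; s≤s)
import Data.Nat.Properties as ℕ
open import Data.Product.Base using (_×_; _,_; proj₁; proj₂; Σ-syntax; ∃; ∃-syntax)
open import Data.Product using (∃!)
open import Data.Sum.Base using (_⊎_; inj₁; inj₂)
open import Data.Vec.Functional using (Vector)
open import Data.Vec.Functional.Relation.Binary.Pointwise using (Pointwise)
import Data.Vec.Functional.Relation.Binary.Pointwise.Properties as Pointwise
open import Function.Bundles using (Bijection; Inverse; _↔_; _⇔_)
open import Level using (Level; 0ℓ; _⊔_) renaming (suc to lsuc)
open import Relation.Binary.Bundles using (Setoid)
import Relation.Binary.Construct.NonStrictToStrict as ToStrict
import Relation.Binary.Construct.On as On
open import Relation.Binary.Lattice.Bundles using (BoundedLattice)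
open import Relation.Binary.PropositionalEquality
  using (_≡_; _≢_; refl; sym; trans; subst)
import Relation.Binary.PropositionalEquality as ≡
open import Relation.Binary.Structures using (IsPartialOrder)
open import Relation.Nullary using (¬_; Dec; yes; no; _×-dec_)

------------------------------------------------------------------------
-- Directed graphs

record Digraph (v e : Level) : Set (lsuc (v ⊔ e)) where
  field
    Vertex : Set v
    Edge   : Vertex → Vertex → Set e

record _≅_ {v e v′ e′ : Level} (G : Digraph v e) (H : Digraph v′ e′) :
           Set (v ⊔ e ⊔ v′ ⊔ e′) where
  private
    module G = Digraph G
    module H = Digraph H
  field
    vertices : G.Vertex ↔ H.Vertex
    edges    : ∀ x y → G.Edge x y ⇔
                 H.Edge (Inverse.to vertices x) (Inverse.to vertices y)

------------------------------------------------------------------------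
-- Extremal lattices and their Galois graphs

-- Only used for finite lattices, which are bounded; ⊥ and ⊤ are the empty
-- join and the empty meet.
module Extremal {c ℓ₁ ℓ₂ : Level} (L : BoundedLattice c ℓ₁ ℓ₂) where

  open BoundedLattice L
  open ToStrict _≈_ _≤_ using (_<_)
  open UniqueSetoid setoid using (Unique)

  _⋖_ : Carrier → Carrier → Set (c ⊔ ℓ₁ ⊔ ℓ₂)
  x ⋖ y = x < y × (∀ z → ¬ (x < z × z < y))

  JoinIrreducible : Carrier → Set (c ⊔ ℓ₁ ⊔ ℓ₂)
  JoinIrreducible x = ∃! _≈_ λ y → y ⋖ x

  MeetIrreducible : Carrier → Set (c ⊔ ℓ₁ ⊔ ℓ₂)
  MeetIrreducible x = ∃! _≈_ λ y → x ⋖ y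

  -- The elements satisfying P, identified when they are equal in L.
  Subsetoid : {p : Level} → (Carrier → Set p) → Setoid (c ⊔ p) ℓ₁
  Subsetoid P = On.setoid {B = ∃ P} setoid proj₁

  -- A labelling of the elements satisfying P by 1, …, k, without repetition.
  Enumeration : {p : Level} → (Carrier → Set p) → ℕ → Set (c ⊔ ℓ₁ ⊔ p)
  Enumeration P k = Bijection (≡.setoid (Fin k)) (Subsetoid P)

  IsChain : List Carrier → Set (c ⊔ ℓ₁ ⊔ ℓ₂)
  IsChain xs = Unique xs × AllPairs (λ x y → x ≤ y ⊎ y ≤ x) xs

  HasLength : ℕ → Set (c ⊔ ℓ₁ ⊔ ℓ₂)
  HasLength k = (∃[ xs ] (IsChain xs × length xs ≡ suc k))
              × (∀ xs → IsChain xs → length xs ℕ.≤ suc k)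

  IsExtremal : ℕ → Set (c ⊔ ℓ₁ ⊔ ℓ₂)
  IsExtremal k = Enumeration JoinIrreducible k
               × Enumeration MeetIrreducible k
               × HasLength k

  ⋁ ⋀ : List Carrier → Carrier
  ⋁ = foldr _∨_ ⊥
  ⋀ = foldr _∧_ ⊤

  record GaloisLabelling (k : ℕ) : Set (c ⊔ ℓ₁ ⊔ ℓ₂) where
    field
      a       : Vector Carrier (suc k)
      a-first : a zero ≈ ⊥
      a-cover : ∀ s → a (inject₁ s) ⋖ a (suc s)
      a-last  : a (fromℕ k) ≈ ⊤

      joinIrreducibles : Enumeration JoinIrreducible k
      meetIrreducibles : Enumeration MeetIrreducible k

    -- Labels start at 0: j s and m s are the irreducibles with label s + 1,
    -- whereas a s keeps its index.
    j : Vector Carrier k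
    j s = proj₁ (Bijection.to joinIrreducibles s)

    m : Vector Carrier k
    m s = proj₁ (Bijection.to meetIrreducibles s)

    field
      joins : ∀ (s : Fin k) →
              ⋁ (take (toℕ (suc s)) (tabulate j)) ≈ a (suc s)
      meets : ∀ (s : Fin k) →
              a (suc s) ≈ ⋀ (drop (toℕ (suc s)) (tabulate m))

  galoisGraph : {k : ℕ} → GaloisLabelling k → Digraph 0ℓ ℓ₂
  galoisGraph {k} l = record
    { Vertex = Fin k
    ; Edge   = λ s t → s ≢ t × ¬ (j s ≤ m t)
    }
    where open GaloisLabelling l

------------------------------------------------------------------------
-- Triwords

-- Positions start at 0, so the first letter is the one at index 0.  T1 is the
-- type Fin 3 of the letters.
record Triword (n : ℕ) : Set where
  field
    word : Vector (Fin 3) n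
    T2   : ∀ i → toℕ i ≡ 0 → word i ≢ 2F
    T3   : ∀ i j → word i ≡ 0F → i Fin.< j → word j ≢ 1F

open Triword

module Max = NaturalMax (Fin.≤-totalOrder 3)
module Min = NaturalMin (Fin.≤-totalOrder 3)
open Max using () renaming (_⊔_ to _max_)
open Min using () renaming (_⊓_ to _min_)

module _ {n : ℕ} where

  _≈ᵗ_ _≤ᵗ_ : Triword n → Triword n → Set
  u ≈ᵗ v = Pointwise _≡_ (word u) (word v)
  u ≤ᵗ v = Pointwise Fin._≤_ (word u) (word v)

  ≤ᵗ-isPartialOrder : IsPartialOrder _≈ᵗ_ _≤ᵗ_
  ≤ᵗ-isPartialOrder = On.isPartialOrder word record
    { isPreorder = record
      { isEquivalence = Pointwise.isEquivalence ≡.isEquivalence n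
      ; reflexive     = λ u≡v i → Fin.≤-reflexive (u≡v i)
      ; trans         = λ u≤v v≤w i → Fin.≤-trans (u≤v i) (v≤w i)
      }
    ; antisym = λ u≤v v≤u i → Fin.≤-antisym (u≤v i) (v≤u i)
    }

  ≤0⇒≡0 : ∀ {x : Fin 3} → Fin._≤_ {3} {3} x 0F → x ≡ 0F
  ≤0⇒≡0 {0F} _ = refl

  ≤1∧≢1⇒≡0 : ∀ {x : Fin 3} → Fin._≤_ {3} {3} x 1F → x ≢ 1F → x ≡ 0F
  ≤1∧≢1⇒≡0 {0F} _       _   = refl
  ≤1∧≢1⇒≡0 {1F} _       x≢1 = ⊥-elim (x≢1 refl)
  ≤1∧≢1⇒≡0 {2F} (s≤s ()) _

  _∨ᵗ_ : Triword n → Triword n → Triword n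
  (u ∨ᵗ v) .word i = word u i max word v i
  (u ∨ᵗ v) .T2 i i≡0 eq with Max.⊔-sel (word u i) (word v i)
  ... | inj₁ p = T2 u i i≡0 (trans (sym p) eq)
  ... | inj₂ p = T2 v i i≡0 (trans (sym p) eq)
  (u ∨ᵗ v) .T3 i j eq i<j eq′ with Max.⊔-sel (word u j) (word v j)
  ... | inj₁ p = T3 u i j
    (≤0⇒≡0 (subst (word u i Fin.≤_) eq (Max.x≤x⊔y (word u i) (word v i))))
    i<j (trans (sym p) eq′)
  ... | inj₂ p = T3 v i j
    (≤0⇒≡0 (subst (word v i Fin.≤_) eq (Max.x≤y⊔x (word u i) (word v i))))
    i<j (trans (sym p) eq′)

  Zeroed : Vector (Fin 3) n → Fin n → Set
  Zeroed w i = w i ≡ 1F × ∃[ j ] (j Fin.< i × w j ≡ 0F)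

  zeroed? : ∀ w i → Dec (Zeroed w i)
  zeroed? w i =
    w i Fin.≟ 1F ×-dec Fin.any? (λ j → j Fin.<? i ×-dec w j Fin.≟ 0F)

  normalise : Vector (Fin 3) n → Vector (Fin 3) n
  normalise w i with zeroed? w i
  ... | yes _ = 0F
  ... | no  _ = w i

  normalise≤ : ∀ w i → normalise w i Fin.≤ w i
  normalise≤ w i with zeroed? w i
  ... | yes _ = z≤n
  ... | no  _ = Fin.≤-refl

  normalise-T3 : ∀ w i j → normalise w i ≡ 0F → i Fin.< j → normalise w j ≢ 1F
  normalise-T3 w i j eq i<j eq′ with zeroed? w j
  ... | no ¬zj with zeroed? w i
  ...   | yes (_ , k , k<i , wk≡0) = ¬zj (eq′ , k , ℕ.<-trans k<i i<j , wk≡0)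
  ...   | no  _                    = ¬zj (eq′ , i , i<j , eq)

  pointwiseMin : Triword n → Triword n → Vector (Fin 3) n
  pointwiseMin u v i = word u i min word v i

  _∧ᵗ_ : Triword n → Triword n → Triword n
  (u ∧ᵗ v) .word = normalise (pointwiseMin u v)
  (u ∧ᵗ v) .T2 i i≡0 eq = T2 u i i≡0
    (Fin.≤-antisym (Fin.≤fromℕ _)
      (Fin.≤-trans
        (subst (Fin._≤ pointwiseMin u v i) eq (normalise≤ (pointwiseMin u v) i))
        (Min.x⊓y≤x (word u i) (word v i))))
  (u ∧ᵗ v) .T3 = normalise-T3 (pointwiseMin u v)

  ⊤ᵗ ⊥ᵗ : Triword n
  ⊤ᵗ .word i with toℕ i
  ... | ℕ.zero = 1F
  ... | suc _  = 2F
  ⊤ᵗ .T2 i i≡0 with toℕ i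
  ... | ℕ.zero = λ ()
  ⊤ᵗ .T3 i _ with toℕ i
  ... | ℕ.zero = λ ()
  ... | suc _  = λ ()
  ⊥ᵗ .word _ = 0F
  ⊥ᵗ .T2 _ _ = λ ()
  ⊥ᵗ .T3 _ _ _ _ = λ ()

  ∧ᵗ≤min : ∀ u v i → word (u ∧ᵗ v) i Fin.≤ word u i min word v i
  ∧ᵗ≤min u v = normalise≤ (pointwiseMin u v)

  ∧ᵗ-greatest : ∀ u v z → z ≤ᵗ u → z ≤ᵗ v → z ≤ᵗ (u ∧ᵗ v)
  ∧ᵗ-greatest u v z z≤u z≤v i
    with zeroed? (pointwiseMin u v) i
  ... | no  _ = Min.⊓-glb (z≤u i) (z≤v i)
  ... | yes (wi≡1 , j , j<i , wj≡0) = Fin.≤-reflexive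
    (≤1∧≢1⇒≡0
      (subst (word z i Fin.≤_) wi≡1 (Min.⊓-glb (z≤u i) (z≤v i)))
      (T3 z j i
        (≤0⇒≡0 (subst (word z j Fin.≤_) wj≡0 (Min.⊓-glb (z≤u j) (z≤v j))))
        j<i))

  ⊤ᵗ-maximum : ∀ u → u ≤ᵗ ⊤ᵗ
  ⊤ᵗ-maximum u i with toℕ i in eq
  ... | suc _  = Fin.≤fromℕ (word u i)
  ... | ℕ.zero with word u i in eq′
  ...   | 0F = z≤n
  ...   | 1F = s≤s z≤n
  ...   | 2F = ⊥-elim (T2 u i eq eq′)

Hoch : ℕ → BoundedLattice 0ℓ 0ℓ 0ℓ
Hoch n = record
  { Carrier = Triword n
  ; _≈_ = _≈ᵗ_
  ; _≤_ = _≤ᵗ_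
  ; _∨_ = _∨ᵗ_
  ; _∧_ = _∧ᵗ_
  ; ⊤   = ⊤ᵗ
  ; ⊥   = ⊥ᵗ
  ; isBoundedLattice = record
    { isLattice = record
      { isPartialOrder = ≤ᵗ-isPartialOrder
      ; supremum = λ u v →
            (λ i → Max.x≤x⊔y (word u i) (word v i))
          , (λ i → Max.x≤y⊔x (word u i) (word v i))
          , (λ z u≤z v≤z i → Max.⊔-lub (u≤z i) (v≤z i))
      ; infimum = λ u v →
            (λ i → Fin.≤-trans (∧ᵗ≤min u v i) (Min.x⊓y≤x (word u i) (word v i)))
          , (λ i → Fin.≤-trans (∧ᵗ≤min u v i) (Min.x⊓y≤y (word u i) (word v i)))
          , ∧ᵗ-greatest u v
      }
    ; maximum = ⊤ᵗ-maximum
    ; minimum = λ _ _ → z≤n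
    }
  }

------------------------------------------------------------------------
-- The explicit graph on {(1,1), …, (1,n), (2,2), …, (2,n)}

explicitGraph : ℕ → Digraph 0ℓ 0ℓ
explicitGraph n = record
  { Vertex = Σ[ (s , t) ∈ ℕ × ℕ ]
               ((s ≡ 1 × 1 ℕ.≤ t × t ℕ.≤ n) ⊎ (s ≡ 2 × 2 ℕ.≤ t × t ℕ.≤ n))
  ; Edge   = λ ((s , t) , _) ((s′ , t′) , _) →
               (s , t) ≢ (s′ , t′)
             × ((s ≡ 2 × s′ ≡ 1 × t ≡ t′) ⊎ (s ≡ 1 × s′ ≡ 1 × t ℕ.> t′))
  }

{-# OPTIONS --safe #-}
module Submission where

-- Suppose a finite lattice has a join-dense family J and a meet-dense family M,
-- both indexed by Fin k, with J s ≰ M s for all s and J s ≤ M t for s < t.  Then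
-- the joins of the initial segments of J form a maximal chain, J and M exhaust the
-- irreducibles, and the lattice is extremal of length k.  In any other labelling
-- j, m, write j s = J (σ s) and m s = M (τ s).  As j s ≰ m s, the permutations σ
-- and τ satisfy τ s ≤ σ s for all s, hence σ = τ.  So the Galois graph is determined
-- by the relation J s ≤ M t.
--
-- In Hoch(n), J consists of 1ⁱ0ⁿ⁻ⁱ (1 ≤ i ≤ n) and of the words with a single
-- nonzero letter 2, at i ≥ 2.  M replaces one letter of the top element 12ⁿ⁻¹, at
-- i, by 0 (i ≥ 1) or by 1 (i ≥ 2).

open import Defs
open import Data.Nat.Base using (ℕ; NonZero)
open import Data.Product.Base using (_×_; ∃-syntax)

open import Data.Fin.Base as Fin using (Fin; zero; suc; toℕ; inject₁; fromℕ<; splitAt; join)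
open import Data.Fin.Patterns using (0F; 1F; 2F)
import Data.Fin.Properties as Fin
open import Data.Fin.Subset as Subset using (Subset; ∣_∣)
open import Data.Fin.Subset.Properties using (∣p∣≤n; p⊂q⇒∣p∣<∣q∣)
open import Data.List.Base as List using (List; length; take; drop)
import Data.List.Properties as List
open import Data.List.Membership.Propositional.Properties using (∈-lookup)
open import Data.List.Relation.Unary.All as All using ()
import Data.List.Relation.Unary.All.Properties as All
open import Data.List.Relation.Unary.AllPairs as AllPairs using (_∷_)
import Data.List.Relation.Unary.AllPairs.Properties as AllPairs
open import Data.List.Relation.Unary.Unique.Propositional using (Unique)
open import Data.Nat.Base as ℕ using (zero; suc; z≤n; s≤s)
import Data.Nat.Induction as ℕ
import Data.Nat.Properties as ℕ
open import Data.Product.Base using (_,_; proj₁; proj₂; ∃)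
open import Data.Sum.Base using (_⊎_; inj₁; inj₂)
import Data.Vec.Base as Vec
import Data.Vec.Properties as Vec
open import Data.Vec.Functional using (Vector; updateAt)
open import Data.Vec.Functional.Properties using (updateAt-updates; updateAt-minimal)
open import Function.Base using (_∘_; const)
open import Function.Bundles using (Bijection; Injection; Inverse; _↔_; _⇔_; mk⇔; mk↔ₛ′; Equivalence)
open import Function.Definitions using (Injective)
import Function.Construct.Composition as Composition
import Function.Construct.Symmetry as Symmetry
open import Function.Properties.Bijection using (Bijection⇒Inverse)
open import Function.Properties.Inverse using (Inverse⇒Injection; ↔-trans)
open import Induction.WellFounded using (WellFounded; Acc; acc; module Subrelation)
open import Level using (Level)
open import Relation.Binary.Construct.On using () renaming (wellFounded to on-wellFounded)
import Relation.Binary.Construct.NonStrictToStrict as ToStrict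
open import Relation.Binary.Definitions using (Decidable; tri<; tri≈; tri>)
open import Relation.Binary.Lattice.Bundles using (BoundedLattice)
open import Relation.Binary.PropositionalEquality
  using (_≡_; _≢_; refl; sym; trans; cong; subst)
open import Relation.Nullary using (¬_; yes; no; does; contradiction)
open import Relation.Nullary.Decidable
  using (decidable-stable; _→-dec_; _×-dec_; map′; dec-true)
open Triword

private variable
  v e : Level
  k k′ n : ℕ

-- Preliminaries on digraphs, repetition-free lists and permutations

≅-trans : {G H K : Digraph v e} → G ≅ H → H ≅ K → G ≅ K
≅-trans G≅H H≅K = record
  { vertices = Composition.inverse (_≅_.vertices G≅H) (_≅_.vertices H≅K)
  ; edges    = λ x y → Composition.equivalence (_≅_.edges G≅H x y) (_≅_.edges H≅K _ _)
  }

lookup-injective : ∀ {xs : List ℕ} → Unique xs → Injective _≡_ _≡_ (List.lookup xs)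
lookup-injective (_ ∷ _)     {zero}  {zero}  _  = refl
lookup-injective (x∉xs ∷ _)  {zero}  {suc j} eq = contradiction eq (All.lookup x∉xs (∈-lookup j))
lookup-injective (x∉xs ∷ _)  {suc i} {zero}  eq =
  contradiction (sym eq) (All.lookup x∉xs (∈-lookup i))
lookup-injective (_ ∷ xs!)   {suc i} {suc j} eq = cong suc (lookup-injective xs! eq)

-- Pigeonhole: the positions of the list inject into the `suc b` possible values. Applied to the
-- ranks of the elements of a chain, this bounds its length.
bounded-unique : ∀ {b} {xs : List ℕ} → (∀ i → List.lookup xs i ℕ.≤ b) → Unique xs →
  length xs ℕ.≤ suc b
bounded-unique xs≤b xs! = Fin.injective⇒≤ {f = λ i → fromℕ< (s≤s (xs≤b i))}
  λ eq → lookup-injective xs! (Fin.fromℕ<-injective _ _ _ _ eq)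

↔-injective : {a b : Level} {A : Set a} {B : Set b} (f : A ↔ B) → Injective _≡_ _≡_ (Inverse.to f)
↔-injective f = Injection.injective (Inverse⇒Injection f)

-- Strong induction on `σ s`. If `τ s < σ s`, the index `r` with `σ r ≡ τ s` has a smaller value, so
-- `τ r ≡ σ r ≡ τ s` by induction. Injectivity of `τ` gives `r ≡ s`, hence `σ s ≡ τ s`, a
-- contradiction.
dominated-permutation : (σ τ : Fin k′ ↔ Fin k) →
  (∀ s → Inverse.to τ s Fin.≤ Inverse.to σ s) → ∀ s → Inverse.to τ s ≡ Inverse.to σ s
dominated-permutation σ τ τ≤σ s = go s (ℕ.<-wellFounded _)
  where
  module σ = Inverse σ
  module τ = Inverse τ
  go : ∀ s → Acc ℕ._<_ (toℕ (σ.to s)) → τ.to s ≡ σ.to s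
  go s (acc rs) with τ.to s Fin.≟ σ.to s
  ... | yes eq = eq
  ... | no neq = contradiction (trans (sym σr≡τs) (cong σ.to r≡s)) neq
    where
    r = σ.from (τ.to s)
    σr≡τs : σ.to r ≡ τ.to s
    σr≡τs = σ.strictlyInverseˡ (τ.to s)
    σr<σs : σ.to r Fin.< σ.to s
    σr<σs = subst (Fin._< σ.to s) (sym σr≡τs) (Fin.≤∧≢⇒< (τ≤σ s) neq)
    r≡s : r ≡ s
    r≡s = ↔-injective τ (trans (go r (rs σr<σs)) σr≡τs)

-- Irreducibles and iterated joins and meets under a decidable order

module DecidableOrder {c ℓ₁ ℓ₂ : Level} (L : BoundedLattice c ℓ₁ ℓ₂)
  (_≤?_ : Decidable (BoundedLattice._≤_ L)) where

  open BoundedLattice L hiding (refl; trans)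
  open BoundedLattice L using () renaming (trans to ≤-trans)
  open Extremal L
  open ToStrict _≈_ _≤_ using (_<_)

  _≈?_ : Decidable _≈_
  x ≈? y = map′ (λ (p , q) → antisym p q) (λ eq → reflexive eq , reflexive (Eq.sym eq))
    (x ≤? y ×-dec y ≤? x)

  <⇒≱ : ∀ {x y} → x < y → ¬ (y ≤ x)
  <⇒≱ = ToStrict.<⇒≱ _≈_ _≤_ antisym

  ≤∧≱⇒< : ∀ {x y} → x ≤ y → ¬ (y ≤ x) → x < y
  ≤∧≱⇒< x≤y y≰x = x≤y , λ eq → y≰x (reflexive (Eq.sym eq))

  -- The greatest element `y` strictly below `x` is its only lower cover: another one, `z`, would
  -- satisfy `z < y < x`.
  joinIrreducible : ∀ {x y} → y < x → (∀ z → z < x → z ≤ y) → JoinIrreducible x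
  joinIrreducible {x} {y} y<x greatest =
    y , (y<x , λ z (y<z , z<x) → <⇒≱ y<z (greatest z z<x)) ,
    λ {z} (z<x , none) → decidable-stable (y ≈? z) λ y≉z →
      none y ((greatest z z<x , y≉z ∘ Eq.sym) , y<x)

  meetIrreducible : ∀ {x y} → x < y → (∀ z → x < z → y ≤ z) → MeetIrreducible x
  meetIrreducible {x} {y} x<y least =
    y , (x<y , λ z (x<z , z<y) → <⇒≱ z<y (least z x<z)) ,
    λ {z} (x<z , none) → decidable-stable (y ≈? z) λ y≉z →
      none y (x<y , (least z x<z , y≉z))

  -- Induction upwards from `z`. Suppose `z ≰ y`. An element strictly between `z` and `x` would be
  -- below `y` by induction, and `z` with it. So `z` is itself a lower cover of `x`, hence equal to
  -- `y`.
  <lowerCover : WellFounded (λ x y → y < x) → ∀ {x} ((y , _) : JoinIrreducible x) →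
    ∀ z → z < x → z ≤ y
  <lowerCover wf {x} (y , _ , unique) z = go z (wf z)
    where
    go : ∀ z → Acc (λ u v → v < u) z → z < x → z ≤ y
    go z (acc rs) z<x = decidable-stable (z ≤? y) λ z≰y →
      z≰y (reflexive (Eq.sym (unique (z<x , λ w (z<w , w<x) →
        z≰y (≤-trans (proj₁ z<w) (go w (rs z<w) w<x))))))

  >upperCover : WellFounded _<_ → ∀ {x} ((y , _) : MeetIrreducible x) →
    ∀ z → x < z → y ≤ z
  >upperCover wf {x} (y , _ , unique) z = go z (wf z)
    where
    go : ∀ z → Acc _<_ z → x < z → y ≤ z
    go z (acc rs) x<z = decidable-stable (y ≤? z) λ y≰z →
      y≰z (reflexive (unique (x<z , λ w (x<w , w<z) →
        y≰z (≤-trans (go w (rs w<z) x<w) (proj₁ w<z)))))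

  -- Sends a label in `e` to the label of the same element in `e′`. That `k′` and `k` agree is a
  -- consequence, not an assumption.
  relabelling : ∀ {p} {P : Carrier → Set p} → Enumeration P k′ → Enumeration P k → Fin k′ ↔ Fin k
  relabelling e e′ =
    Composition.inverse (Bijection⇒Inverse e) (Symmetry.inverse (Bijection⇒Inverse e′))

  ⋁-take-upper : (f : Vector Carrier k) (t : ℕ) (s : Fin k) → toℕ s ℕ.< t →
    f s ≤ ⋁ (take t (List.tabulate f))
  ⋁-take-upper f (suc t) zero    _         = x≤x∨y _ _
  ⋁-take-upper f (suc t) (suc s) (s≤s s<t) =
    ≤-trans (⋁-take-upper (f ∘ suc) t s s<t) (y≤x∨y _ _)

  ⋁-take-least : (f : Vector Carrier k) (t : ℕ) {u : Carrier} →
    (∀ s → toℕ s ℕ.< t → f s ≤ u) → ⋁ (take t (List.tabulate f)) ≤ u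
  ⋁-take-least {zero}  f zero    _   = minimum _
  ⋁-take-least {zero}  f (suc t) _   = minimum _
  ⋁-take-least {suc k} f zero    _   = minimum _
  ⋁-take-least {suc k} f (suc t) f≤u =
    ∨-least (f≤u zero (s≤s z≤n)) (⋁-take-least (f ∘ suc) t λ s s<t → f≤u (suc s) (s≤s s<t))

  ⋀-drop-lower : (f : Vector Carrier k) (t : ℕ) (s : Fin k) → t ℕ.≤ toℕ s →
    ⋀ (drop t (List.tabulate f)) ≤ f s
  ⋀-drop-lower f zero    zero    _         = x∧y≤x _ _
  ⋀-drop-lower f zero    (suc s) _         =
    ≤-trans (x∧y≤y _ _) (⋀-drop-lower (f ∘ suc) zero s z≤n)
  ⋀-drop-lower f (suc t) (suc s) (s≤s t≤s) = ⋀-drop-lower (f ∘ suc) t s t≤s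

  ⋀-drop-greatest : (f : Vector Carrier k) (t : ℕ) {u : Carrier} →
    (∀ s → t ℕ.≤ toℕ s → u ≤ f s) → u ≤ ⋀ (drop t (List.tabulate f))
  ⋀-drop-greatest {zero}  f zero    _   = maximum _
  ⋀-drop-greatest {zero}  f (suc t) _   = maximum _
  ⋀-drop-greatest {suc k} f zero    u≤f =
    ∧-greatest (u≤f zero z≤n) (⋀-drop-greatest (f ∘ suc) zero λ s _ → u≤f (suc s) z≤n)
  ⋀-drop-greatest {suc k} f (suc t) u≤f =
    ⋀-drop-greatest (f ∘ suc) t λ s t≤s → u≤f (suc s) (s≤s t≤s)

  -- Triangular families and their maximal chain

  module TriangularFamilies
    {k : ℕ} (J M : Vector Carrier k)
    -- Join-density in terms of the order alone: every `x` is the least upper bound of the members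
    -- of `J` below it. `M-dense` is the dual.
    (J-dense : ∀ x y → (∀ s → J s ≤ x → J s ≤ y) → x ≤ y)
    (M-dense : ∀ x y → (∀ s → x ≤ M s → y ≤ M s) → y ≤ x)
    (J≤M : ∀ {s t} → s Fin.< t → J s ≤ M t)
    (J≰M : ∀ s → ¬ (J s ≤ M s))
    where

    chain : ℕ → Carrier
    chain t = ⋁ (take t (List.tabulate J))

    J≤chain : ∀ {s t} → toℕ s ℕ.< t → J s ≤ chain t
    J≤chain = ⋁-take-upper J _ _

    chain≤M : ∀ {t s} → t ℕ.≤ toℕ s → chain t ≤ M s
    chain≤M t≤s = ⋁-take-least J _ λ r r<t → J≤M (ℕ.<-≤-trans r<t t≤s)

    -- If `t ≤ s`, triangularity puts `chain t` below `M s`, and then `J s ≤ M s`. So `J s` enters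
    -- the chain exactly at index `s + 1`, which is also where the chain leaves the down-set of
    -- `M s`.
    J≤chain⇒< : ∀ {s t} → J s ≤ chain t → toℕ s ℕ.< t
    J≤chain⇒< {s} J≤ = ℕ.≰⇒> λ t≤s → J≰M s (≤-trans J≤ (chain≤M t≤s))

    chain≤M⇒≤ : ∀ {t s} → chain t ≤ M s → t ℕ.≤ toℕ s
    chain≤M⇒≤ {_} {s} ≤M = ℕ.≮⇒≥ λ s<t → J≰M s (≤-trans (J≤chain s<t) ≤M)

    chain-mono : ∀ {s t} → s ℕ.≤ t → chain s ≤ chain t
    chain-mono s≤t = J-dense _ _ λ r J≤ → J≤chain (ℕ.<-≤-trans (J≤chain⇒< J≤) s≤t)

    J≰chain : ∀ s → ¬ (J s ≤ chain (toℕ s))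
    J≰chain s = ℕ.<-irrefl refl ∘ J≤chain⇒<

    chain≰M : ∀ s → ¬ (chain (suc (toℕ s)) ≤ M s)
    chain≰M s = ℕ.<-irrefl refl ∘ chain≤M⇒≤

    -- The members of `J` below `x` have label at most `s`, and label `s` itself is excluded;
    -- density concludes.
    ≤chain-step : ∀ {x} s → x ≤ chain (suc (toℕ s)) → ¬ (J s ≤ x) → x ≤ chain (toℕ s)
    ≤chain-step {x} s x≤ J≰x = J-dense _ _ λ r J≤x → J≤chain
      (Fin.≤∧≢⇒< (ℕ.s≤s⁻¹ (J≤chain⇒< (≤-trans J≤x x≤))) λ { refl → J≰x J≤x })

    chain-step≤ : ∀ {x} s → chain (toℕ s) ≤ x → ¬ (x ≤ M s) → chain (suc (toℕ s)) ≤ x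
    chain-step≤ {x} s ≤x x≰M = M-dense _ _ λ r x≤M → chain≤M
      (Fin.≤∧≢⇒< (chain≤M⇒≤ (≤-trans ≤x x≤M)) λ { refl → x≰M x≤M })

    chain-cover : ∀ s → chain (toℕ s) ⋖ chain (suc (toℕ s))
    chain-cover s =
      ≤∧≱⇒< (chain-mono (ℕ.n≤1+n _)) (λ back → J≰chain s (≤-trans (J≤chain ℕ.≤-refl) back)) ,
      -- An intermediate `z` either lies above `J s`, hence above `chain (suc s)`, or does not, and
      -- then lies below `chain s`.
      λ z (<z , z<) → <⇒≱ <z (≤chain-step s (proj₁ z<) λ J≤z →
        <⇒≱ z< (⋁-take-least J _ λ r r≤s → below z <z J≤z r r≤s))
      where
      below : ∀ z → chain (toℕ s) < z → J s ≤ z → ∀ r → toℕ r ℕ.< suc (toℕ s) → J r ≤ z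
      below z <z J≤z r r≤s with r Fin.≟ s
      ... | yes refl = J≤z
      ... | no r≢s   = ≤-trans (J≤chain (Fin.≤∧≢⇒< (ℕ.s≤s⁻¹ r≤s) r≢s)) (proj₁ <z)

    -- The lower cover is `J s ∧ chain (toℕ s)`: whatever is strictly below `J s` is below the next
    -- chain element without being above `J s`, so `≤chain-step` applies.
    J-joinIrreducible : ∀ s → JoinIrreducible (J s)
    J-joinIrreducible s = joinIrreducible {y = J s ∧ chain (toℕ s)}
      (≤∧≱⇒< (x∧y≤x _ _) λ J≤ → J≰chain s (≤-trans J≤ (x∧y≤y _ _)))
      λ z z<J → ∧-greatest (proj₁ z<J)
        (≤chain-step s (≤-trans (proj₁ z<J) (J≤chain ℕ.≤-refl)) (<⇒≱ z<J))

    M-meetIrreducible : ∀ s → MeetIrreducible (M s)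
    M-meetIrreducible s = meetIrreducible {y = M s ∨ chain (suc (toℕ s))}
      (≤∧≱⇒< (x≤x∨y _ _) λ ≤M → chain≰M s (≤-trans (y≤x∨y _ _) ≤M))
      λ z M<z → ∨-least (proj₁ M<z)
        (chain-step≤ s (≤-trans (chain≤M ℕ.≤-refl) (proj₁ M<z)) (<⇒≱ M<z))

    J-injective : ∀ {s t} → J s ≈ J t → s ≡ t
    J-injective {s} {t} eq with Fin.<-cmp s t
    ... | tri< s<t _ _ = contradiction (≤-trans (reflexive (Eq.sym eq)) (J≤M s<t)) (J≰M t)
    ... | tri≈ _ s≡t _ = s≡t
    ... | tri> _ _ t<s = contradiction (≤-trans (reflexive eq) (J≤M t<s)) (J≰M s)

    M-injective : ∀ {s t} → M s ≈ M t → s ≡ t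
    M-injective {s} {t} eq with Fin.<-cmp s t
    ... | tri< s<t _ _ = contradiction (≤-trans (J≤M s<t) (reflexive (Eq.sym eq))) (J≰M s)
    ... | tri≈ _ s≡t _ = s≡t
    ... | tri> _ _ t<s = contradiction (≤-trans (J≤M t<s) (reflexive eq)) (J≰M t)

    -- The size of the support is strictly monotone: this bounds the length of chains
    -- and makes both < and > well-founded.
    support : Carrier → Subset k
    support x = Vec.tabulate λ s → does (J s ≤? x)

    ∈-support⁺ : ∀ {x s} → J s ≤ x → s Subset.∈ support x
    ∈-support⁺ {x} {s} J≤x = Vec.lookup⇒[]= s _
      (trans (Vec.lookup∘tabulate _ s) (dec-true (J s ≤? x) J≤x))

    ∈-support⁻ : ∀ {x s} → s Subset.∈ support x → J s ≤ x
    ∈-support⁻ {x} {s} s∈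
      with J s ≤? x
         | trans (sym (Vec.lookup∘tabulate (λ s → does (J s ≤? x)) s)) (Vec.[]=⇒lookup s∈)
    ... | yes J≤x | _ = J≤x

    rank : Carrier → ℕ
    rank x = ∣ support x ∣

    rank-mono-< : ∀ {x y} → x < y → rank x ℕ.< rank y
    rank-mono-< {x} {y} x<y
      -- As `y ≰ x`, density fails at some label; finiteness and decidability provide it. This label
      -- is in the support of `y` but not in that of `x`.
      with s , ¬J≤y⇒J≤x ← Fin.¬∀⟶∃¬ k _ (λ s → J s ≤? y →-dec J s ≤? x) (<⇒≱ x<y ∘ J-dense y x)
      = p⊂q⇒∣p∣<∣q∣
      ( (λ s∈ → ∈-support⁺ (≤-trans (∈-support⁻ s∈) (proj₁ x<y)))
      , s
      , ∈-support⁺ (decidable-stable (J s ≤? y) λ J≰y → ¬J≤y⇒J≤x λ J≤y → contradiction J≤y J≰y)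
      , λ s∈ → ¬J≤y⇒J≤x λ _ → ∈-support⁻ s∈
      )

    <-wellFounded : WellFounded _<_
    <-wellFounded = Subrelation.wellFounded rank-mono-< (on-wellFounded rank ℕ.<-wellFounded)

    >-wellFounded : WellFounded (λ x y → y < x)
    >-wellFounded = Subrelation.wellFounded
      (λ {x} y<x → ℕ.∸-monoʳ-< (rank-mono-< y<x) (∣p∣≤n (support x)))
      (on-wellFounded (λ x → k ℕ.∸ rank x) ℕ.<-wellFounded)

    -- Exhaustion of the irreducibles and extremality

    joinIrreducible⇒J : ∀ {x} → JoinIrreducible x → ∃ λ s → J s ≈ x
    joinIrreducible⇒J {x} ji@(y , (y<x , _) , _) =
      -- If no `J s` equals `x`, every member of `J` below `x` is strictly below it, hence below its
      -- lower cover `y`. Density then gives `x ≤ y`.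
      decidable-stable (Fin.any? λ s → J s ≈? x) λ none →
        <⇒≱ y<x (J-dense _ _ λ s J≤x →
          <lowerCover >-wellFounded ji (J s) (J≤x , λ eq → none (s , eq)))

    meetIrreducible⇒M : ∀ {x} → MeetIrreducible x → ∃ λ s → M s ≈ x
    meetIrreducible⇒M {x} mi@(y , (x<y , _) , _) =
      decidable-stable (Fin.any? λ s → M s ≈? x) λ none →
        <⇒≱ x<y (M-dense _ _ λ s x≤M →
          >upperCover <-wellFounded mi (M s) (x≤M , λ eq → none (s , Eq.sym eq)))

    enumerateJ : Enumeration JoinIrreducible k
    enumerateJ = record
      { to        = λ s → J s , J-joinIrreducible s
      ; cong      = λ { refl → Eq.refl }
      ; bijective = J-injective , λ (_ , ji) →
          proj₁ (joinIrreducible⇒J ji) , λ { refl → proj₂ (joinIrreducible⇒J ji) }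
      }

    enumerateM : Enumeration MeetIrreducible k
    enumerateM = record
      { to        = λ s → M s , M-meetIrreducible s
      ; cong      = λ { refl → Eq.refl }
      ; bijective = M-injective , λ (_ , mi) →
          proj₁ (meetIrreducible⇒M mi) , λ { refl → proj₂ (meetIrreducible⇒M mi) }
      }

    chain-length≤ : ∀ xs → IsChain xs → length xs ℕ.≤ suc k
    chain-length≤ xs (xs! , comparable) = subst (ℕ._≤ suc k) (List.length-map rank xs)
      (bounded-unique ranks≤k
        (AllPairs.map⁺ (AllPairs.zipWith (λ (x≉y , c) → rank≢ x≉y c) (xs! , comparable))))
      where
      rank≢ : ∀ {x y} → ¬ (x ≈ y) → x ≤ y ⊎ y ≤ x → rank x ≢ rank y
      rank≢ x≉y (inj₁ x≤y) = ℕ.<⇒≢ (rank-mono-< (x≤y , x≉y))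
      rank≢ x≉y (inj₂ y≤x) = ℕ.>⇒≢ (rank-mono-< (y≤x , x≉y ∘ Eq.sym))
      ranks≤k : ∀ i → List.lookup (List.map rank xs) i ℕ.≤ k
      ranks≤k i = All.lookup {P = ℕ._≤ k}
        (All.map⁺ (All.universal (λ x → ∣p∣≤n (support x)) xs)) (∈-lookup i)

    chain-< : ∀ {s t : Fin (suc k)} → s Fin.< t → chain (toℕ s) < chain (toℕ t)
    chain-< {s} {t} s<t = chain-mono (ℕ.<⇒≤ s<t) , λ eq → J≰chain′ (reflexive (Eq.sym eq))
      where
      r : Fin k
      -- As `s < t ≤ k`, the index `s` is also a label; its `J` lies below `chain t` but not below
      -- `chain s`.
      r = fromℕ< (ℕ.<-≤-trans s<t (Fin.toℕ≤pred[n] t))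
      r≡s : toℕ r ≡ toℕ s
      r≡s = Fin.toℕ-fromℕ< _
      J≰chain′ : ¬ (chain (toℕ t) ≤ chain (toℕ s))
      J≰chain′ t≤s = ℕ.<-irrefl r≡s
        (J≤chain⇒< (≤-trans (J≤chain (subst (ℕ._< toℕ t) (sym r≡s) s<t)) t≤s))

    isExtremal : IsExtremal k
    isExtremal = enumerateJ , enumerateM ,
      ( List.tabulate {n = suc k} (chain ∘ toℕ)
      , ( AllPairs.tabulate⁺-< (λ s<t → proj₂ (chain-< s<t))
        , AllPairs.tabulate⁺-< (λ s<t → inj₁ (proj₁ (chain-< s<t))))
      , List.length-tabulate {n = suc k} (chain ∘ toℕ)
      ) , chain-length≤

    galoisLabelling : GaloisLabelling k
    galoisLabelling = record
      { a                = chain ∘ toℕ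
      ; a-first          = Eq.refl
      ; a-cover          = λ s → subst (λ t → chain t ⋖ chain (suc (toℕ s)))
          (sym (Fin.toℕ-inject₁ s)) (chain-cover s)
      -- A member of `M` above `chain k` would have label at least `k`. There is none, so the top is
      -- below `chain k` by density.
      ; a-last           = antisym (maximum _)
          (M-dense _ _ λ s ≤M → contradiction (Fin.toℕ<n s)
            (ℕ.≤⇒≯ (subst (ℕ._≤ toℕ s) (Fin.toℕ-fromℕ k) (chain≤M⇒≤ ≤M))))
      ; joinIrreducibles = enumerateJ
      ; meetIrreducibles = enumerateM
      ; joins            = λ s → Eq.refl
      ; meets            = λ s → antisym
          (⋀-drop-greatest M (suc (toℕ s)) λ r s<r → chain≤M s<r)
          (M-dense _ _ λ r ≤M → ⋀-drop-lower M (suc (toℕ s)) r (chain≤M⇒≤ ≤M))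
      }

    -- Comparison with an arbitrary Galois labelling

    module _ {k′ : ℕ} (l : GaloisLabelling k′) where
      open GaloisLabelling l

      σ τ : Fin k′ ↔ Fin k
      σ = relabelling joinIrreducibles enumerateJ
      τ = relabelling meetIrreducibles enumerateM

      Jσ≈j : ∀ s → J (Inverse.to σ s) ≈ j s
      Jσ≈j s = Inverse.strictlyInverseˡ (Bijection⇒Inverse enumerateJ) (Bijection.to joinIrreducibles s)

      Mτ≈m : ∀ s → M (Inverse.to τ s) ≈ m s
      Mτ≈m s = Inverse.strictlyInverseˡ (Bijection⇒Inverse enumerateM) (Bijection.to meetIrreducibles s)

      -- Density passes from `M` to `m` along the bijection `τ`. It yields that the meet of all the
      -- `m t` is the bottom.
      m-dense : ∀ x y → (∀ s → x ≤ m s → y ≤ m s) → y ≤ x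
      m-dense x y h = M-dense x y λ s x≤M →
        let eq = Eq.trans (Eq.sym (Mτ≈m (Inverse.from τ s)))
                   (Eq.reflexive (cong M (Inverse.strictlyInverseˡ τ s)))
        in ≤-trans (h _ (≤-trans x≤M (reflexive (Eq.sym eq)))) (reflexive eq)

      j≤a : ∀ {r s} → r Fin.≤ s → j r ≤ a (suc s)
      j≤a {r} {s} r≤s = ≤-trans (⋁-take-upper j _ r (s≤s r≤s)) (reflexive (joins s))

      a≤m : ∀ {s t} → s Fin.< t → a (suc s) ≤ m t
      a≤m {s} {t} s<t = ≤-trans (reflexive (meets s)) (⋀-drop-lower m _ t s<t)

      -- The field meets says nothing about a zero, hence the case split.
      meet-tail : ∀ s {x} → (∀ t → s Fin.≤ t → x ≤ m t) → x ≤ a (inject₁ s)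
      meet-tail zero    x≤m = m-dense _ _ λ t _ → x≤m t z≤n
      meet-tail (suc s) {x} x≤m = ≤-trans
        (⋀-drop-greatest m (suc (toℕ (inject₁ s))) λ t s<t →
          x≤m t (subst (λ r → suc r ℕ.≤ toℕ t) (Fin.toℕ-inject₁ s) s<t))
        (reflexive (Eq.sym (meets (inject₁ s))))

      -- Otherwise every `j r` with `r ≤ s` is below `m s`, and so is their join `a (suc s)`. As
      -- `a (suc s)` is below all later `m t` as well, it is below `a (inject₁ s)`, against the
      -- covering relation.
      j≰m : ∀ s → ¬ (j s ≤ m s)
      j≰m s j≤m = <⇒≱ (proj₁ (a-cover s)) (meet-tail s a≤)
        where
        j≤ : ∀ r → toℕ r ℕ.≤ toℕ s → j r ≤ m s
        j≤ r r≤s with r Fin.≟ s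
        ... | yes refl = j≤m
        ... | no r≢s   = ≤-trans (j≤a ℕ.≤-refl) (a≤m (Fin.≤∧≢⇒< r≤s r≢s))
        a≤ : ∀ t → s Fin.≤ t → a (suc s) ≤ m t
        a≤ t s≤t with s Fin.≟ t
        ... | yes refl = ≤-trans (reflexive (Eq.sym (joins s)))
                           (⋁-take-least j _ λ r r≤s → j≤ r (ℕ.s≤s⁻¹ r≤s))
        ... | no s≢t   = a≤m (Fin.≤∧≢⇒< s≤t s≢t)

      τ≡σ : ∀ s → Inverse.to τ s ≡ Inverse.to σ s
      τ≡σ = dominated-permutation σ τ λ s → ℕ.≮⇒≥ λ σ<τ →
        j≰m s (≤-trans (reflexive (Eq.sym (Jσ≈j s))) (≤-trans (J≤M σ<τ) (reflexive (Mτ≈m s))))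

      Mσ≈m : ∀ s → M (Inverse.to σ s) ≈ m s
      Mσ≈m s = Eq.trans (Eq.reflexive (cong M (sym (τ≡σ s)))) (Mτ≈m s)

      galoisGraph-unique : galoisGraph l ≅ galoisGraph galoisLabelling
      galoisGraph-unique = record
        { vertices = σ
        ; edges    = λ s t → mk⇔
            (λ (s≢t , j≰m) → (s≢t ∘ ↔-injective σ) , λ J≤M → j≰m
              (≤-trans (reflexive (Eq.sym (Jσ≈j s))) (≤-trans J≤M (reflexive (Mσ≈m t)))))
            (λ (σs≢σt , J≰M) → (σs≢σt ∘ cong (Inverse.to σ)) , λ j≤m → J≰M
              (≤-trans (reflexive (Jσ≈j s)) (≤-trans j≤m (reflexive (Eq.sym (Mσ≈m t))))))
        }

-- The irreducible triwords

_≤?ᵗ_ : Decidable (_≤ᵗ_ {n})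
u ≤?ᵗ v = Fin.all? λ i → word u i Fin.≤? word v i

≢0⇒1≤ : ∀ {x : Fin 3} → x ≢ 0F → 1 ℕ.≤ toℕ x
≢0⇒1≤ {zero}  x≢0 = contradiction refl x≢0
≢0⇒1≤ {suc _} _   = s≤s z≤n

≢2⇒≤1 : ∀ {x : Fin 3} → x ≢ 2F → toℕ x ℕ.≤ 1
≢2⇒≤1 {0F} _   = z≤n
≢2⇒≤1 {1F} _   = s≤s z≤n
≢2⇒≤1 {2F} x≢2 = contradiction refl x≢2

step : Fin n → Vector (Fin 3) n
step i x with x Fin.≤? i
... | yes _ = 1F
... | no  _ = 0F

step-≤ : ∀ {i x : Fin n} → x Fin.≤ i → step i x ≡ 1F
step-≤ {i = i} {x} x≤i with x Fin.≤? i
... | yes _   = refl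
... | no x≰i  = contradiction x≤i x≰i

step-> : ∀ {i x : Fin n} → i Fin.< x → step i x ≡ 0F
step-> {i = i} {x} i<x with x Fin.≤? i
... | yes x≤i = contradiction x≤i (ℕ.<⇒≱ i<x)
... | no _    = refl

step≤1 : ∀ (i x : Fin n) → toℕ (step i x) ℕ.≤ 1
step≤1 i x with x Fin.≤? i
... | yes _ = s≤s z≤n
... | no  _ = z≤n

initialOnes : Fin n → Triword n
initialOnes i .word = step i
initialOnes i .T2 x _ eq with s≤s () ← subst (λ a → toℕ a ℕ.≤ 1) eq (step≤1 i x)
initialOnes i .T3 x y eq x<y eq′ with x Fin.≤? i | y Fin.≤? i
initialOnes i .T3 x y () x<y eq′ | yes _  | _
initialOnes i .T3 x y eq x<y eq′ | no x≰i | yes y≤i = x≰i (ℕ.≤-trans (ℕ.<⇒≤ x<y) y≤i)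
initialOnes i .T3 x y eq x<y ()  | no _   | no _

_[_≔_] : Vector (Fin 3) n → Fin n → Fin 3 → Vector (Fin 3) n
w [ i ≔ a ] = updateAt w i (const a)

-- The predicate may depend on the position, so that pointwise comparisons with an updated word are
-- instances.
≔-elim : ∀ {p} (P : Fin n → Fin 3 → Set p) (w : Vector (Fin 3) n) i {a} →
  P i a → (∀ x → x ≢ i → P x (w x)) → ∀ x → P x ((w [ i ≔ a ]) x)
≔-elim P w i Pia Pw x with x Fin.≟ i
... | yes refl = subst (P i) (sym (updateAt-updates i w)) Pia
... | no x≢i   = subst (P x) (sym (updateAt-minimal x i w x≢i)) (Pw x x≢i)

-- The index is shifted because T2 forbids the letter 2 at position 0.
isolatedTwo : Fin n → Triword (suc n)
isolatedTwo i .word = (λ _ → 0F) [ suc i ≔ 2F ]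
isolatedTwo i .T2 zero _ ()
isolatedTwo i .T3 _ y _ _ = ≔-elim (λ _ a → a ≢ 1F) (λ _ → 0F) (suc i) (λ ()) (λ _ _ ()) y

topWithZero : Fin (suc n) → Triword (suc n)
topWithZero i .word = word ⊤ᵗ [ i ≔ 0F ]
topWithZero zero    .T2 zero _ ()
topWithZero (suc i) .T2 zero _ ()
-- The only letter 1 of the top word is at position 0, which has nothing to its left.
topWithZero i .T3 x (suc y) _ _ = ≔-elim (λ z a → z ≢ 0F → a ≢ 1F) (word ⊤ᵗ) i (λ _ ())
  (λ { zero _ 0≢0 → contradiction refl 0≢0 ; (suc _) _ _ () }) (suc y) λ ()

-- The index is shifted because the top word already has the letter 1 at position 0. T3 holds as no
-- letter is 0.
topWithOne : Fin n → Triword (suc n)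
topWithOne i .word = word ⊤ᵗ [ suc i ≔ 1F ]
topWithOne i .T2 zero _ ()
topWithOne i .T3 x _ eq _ = contradiction eq
  (≔-elim (λ _ a → a ≢ 0F) (word ⊤ᵗ) (suc i) (λ ()) (λ { zero _ () ; (suc _) _ () }) x)

-- Comparisons with irreducible words as conditions on letters

initialOnes≤⁺ : ∀ {i} (u : Triword n) → (∀ x → x Fin.≤ i → word u x ≢ 0F) → initialOnes i ≤ᵗ u
initialOnes≤⁺ {i = i} u u≢0 x with x Fin.≤? i
... | yes x≤i = ≢0⇒1≤ (u≢0 x x≤i)
... | no _    = z≤n

initialOnes≤⁻ : ∀ {i} (u : Triword n) → initialOnes i ≤ᵗ u → ∀ x → x Fin.≤ i → word u x ≢ 0F
initialOnes≤⁻ u ≤u x x≤i eq with () ← subst (ℕ._≤ 0) (cong toℕ (step-≤ x≤i))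
  (subst (λ a → toℕ (step _ x) ℕ.≤ toℕ a) eq (≤u x))

isolatedTwo≤⁺ : ∀ {i} (u : Triword (suc n)) → word u (suc i) ≡ 2F → isolatedTwo i ≤ᵗ u
isolatedTwo≤⁺ {i = i} u eq = ≔-elim (λ x a → a Fin.≤ word u x) (λ _ → 0F) (suc i)
  (Fin.≤-reflexive (sym eq)) (λ _ _ → z≤n)

isolatedTwo≤⁻ : ∀ {i} (u : Triword (suc n)) → isolatedTwo i ≤ᵗ u → word u (suc i) ≡ 2F
isolatedTwo≤⁻ {i = i} u ≤u = Fin.≤-antisym (Fin.≤fromℕ _)
  (subst (Fin._≤ word u (suc i)) (updateAt-updates (suc i) (λ _ → 0F)) (≤u (suc i)))

≤topWithZero⁺ : ∀ i (u : Triword (suc n)) → word u i ≡ 0F → u ≤ᵗ topWithZero i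
≤topWithZero⁺ i u eq = ≔-elim (λ x a → word u x Fin.≤ a) (word ⊤ᵗ) i
  (Fin.≤-reflexive eq) (λ x _ → ⊤ᵗ-maximum u x)

≤topWithZero⁻ : ∀ i (u : Triword (suc n)) → u ≤ᵗ topWithZero i → word u i ≡ 0F
≤topWithZero⁻ i u u≤ = Fin.toℕ-injective (ℕ.n≤0⇒n≡0
  (subst (word u i Fin.≤_) (updateAt-updates i (word ⊤ᵗ)) (u≤ i)))

≤topWithOne⁺ : ∀ i (u : Triword (suc n)) → toℕ (word u (suc i)) ℕ.≤ 1 → u ≤ᵗ topWithOne i
≤topWithOne⁺ i u ≤1 = ≔-elim (λ x a → word u x Fin.≤ a) (word ⊤ᵗ) (suc i)
  ≤1 (λ x _ → ⊤ᵗ-maximum u x)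

≤topWithOne⁻ : ∀ i (u : Triword (suc n)) → u ≤ᵗ topWithOne i → toℕ (word u (suc i)) ℕ.≤ 1
≤topWithOne⁻ i u u≤ =
  subst (word u (suc i) Fin.≤_) (updateAt-updates (suc i) (word ⊤ᵗ)) (u≤ (suc i))

-- The triangular families of the Hochschild lattice

module HochIrreducibles (m : ℕ) where

  -- inj₁ i labels the vertex (1 , i + 1) and inj₂ i the vertex (2 , i + 2).
  Label : Set
  Label = Fin (suc m) ⊎ Fin m

  Jᴸ Mᴸ : Label → Triword (suc m)
  Jᴸ (inj₁ i) = initialOnes i
  Jᴸ (inj₂ i) = isolatedTwo i
  Mᴸ (inj₁ i) = topWithZero i
  Mᴸ (inj₂ i) = topWithOne i

  -- Each letter of `u` is witnessed by a member of `Jᴸ` below `u`. By T3 a letter 1 at `x` has no 0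
  -- to its left, so `initialOnes x ≤ᵗ u`. A letter 2 is not at position 0, by T2, and gives an
  -- `isolatedTwo`.
  Jᴸ-dense : ∀ u v → (∀ p → Jᴸ p ≤ᵗ u → Jᴸ p ≤ᵗ v) → u ≤ᵗ v
  Jᴸ-dense u v h x with word u x in eq
  Jᴸ-dense u v h x | 0F = z≤n
  Jᴸ-dense u v h x | 1F = ≢0⇒1≤ (initialOnes≤⁻ v (h (inj₁ x) (initialOnes≤⁺ u u≢0)) x ℕ.≤-refl)
    where
    u≢0 : ∀ y → y Fin.≤ x → word u y ≢ 0F
    u≢0 y y≤x eq′ with y Fin.≟ x
    ... | no y≢x   = T3 u y x eq′ (Fin.≤∧≢⇒< y≤x y≢x) eq
    ... | yes refl with () ← trans (sym eq) eq′
  Jᴸ-dense u v h zero    | 2F = contradiction eq (T2 u zero refl)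
  Jᴸ-dense u v h (suc i) | 2F =
    Fin.≤-reflexive (sym (isolatedTwo≤⁻ v (h (inj₂ i) (isolatedTwo≤⁺ u eq))))

  -- Dually, a letter 0 or 1 of `u` is an upper bound imposed by a `topWithZero` or a `topWithOne`;
  -- at position 0 the bound 1 is T2 for `v`.
  Mᴸ-dense : ∀ u v → (∀ p → u ≤ᵗ Mᴸ p → v ≤ᵗ Mᴸ p) → v ≤ᵗ u
  Mᴸ-dense u v h x with word u x in eq
  Mᴸ-dense u v h x       | 0F = Fin.≤-reflexive (≤topWithZero⁻ x v (h (inj₁ x) (≤topWithZero⁺ x u eq)))
  Mᴸ-dense u v h zero    | 1F = ≢2⇒≤1 (T2 v zero refl)
  Mᴸ-dense u v h (suc i) | 1F =
    ≤topWithOne⁻ i v (h (inj₂ i) (≤topWithOne⁺ i u (ℕ.≤-reflexive (cong toℕ eq))))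
  Mᴸ-dense u v h x       | 2F = Fin.≤fromℕ (word v x)

  isolatedTwo-elsewhere : ∀ {i : Fin m} {x} → suc i ≢ x → word (isolatedTwo i) x ≡ 0F
  isolatedTwo-elsewhere {i} {x} i≢x = updateAt-minimal x (suc i) (λ _ → 0F) (i≢x ∘ sym)

  initialOnes≤topWithOne : ∀ i k → initialOnes i ≤ᵗ topWithOne {m} k
  initialOnes≤topWithOne i k = ≤topWithOne⁺ k (initialOnes i) (step≤1 i (suc k))

  isolatedTwo≤topWithZero : ∀ {i k} → suc i ≢ k → isolatedTwo i ≤ᵗ topWithZero {m} k
  isolatedTwo≤topWithZero {i} {k} i≢k = ≤topWithZero⁺ k (isolatedTwo i) (isolatedTwo-elsewhere i≢k)

  isolatedTwo≤topWithOne : ∀ {i k} → i ≢ k → isolatedTwo i ≤ᵗ topWithOne {m} k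
  isolatedTwo≤topWithOne {i} {k} i≢k = ≤topWithOne⁺ k (isolatedTwo i)
    (subst (λ a → toℕ a ℕ.≤ 1) (sym (isolatedTwo-elsewhere (i≢k ∘ Fin.suc-injective))) z≤n)

  isolatedTwo≰topWithZero : ∀ i → ¬ (isolatedTwo i ≤ᵗ topWithZero {m} (suc i))
  isolatedTwo≰topWithZero i ≤M
    with () ← trans (sym (updateAt-updates (suc i) (λ _ → 0F)))
      (≤topWithZero⁻ (suc i) (isolatedTwo i) ≤M)

  -- `join` orders all `inj₁` labels before all `inj₂` labels. Hence the failing comparison of
  -- `isolatedTwo i` with `topWithZero (suc i)` goes from a larger label to a smaller one, as
  -- triangularity allows.
  Jᴸ≤Mᴸ : ∀ p q → join (suc m) m p Fin.< join (suc m) m q → Jᴸ p ≤ᵗ Mᴸ q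
  Jᴸ≤Mᴸ (inj₁ i) (inj₁ k) i<k = ≤topWithZero⁺ k (initialOnes i)
    (step-> (ℕ.≤-trans (ℕ.≤-reflexive (cong suc (sym (Fin.toℕ-↑ˡ i m))))
      (ℕ.≤-trans i<k (ℕ.≤-reflexive (Fin.toℕ-↑ˡ k m)))))
  Jᴸ≤Mᴸ (inj₁ i) (inj₂ k) _   = initialOnes≤topWithOne i k
  Jᴸ≤Mᴸ (inj₂ i) (inj₁ k) i<k = contradiction i<k (ℕ.≤⇒≯
    (ℕ.≤-trans (ℕ.≤-reflexive (Fin.toℕ-↑ˡ k m))
      (ℕ.≤-trans (ℕ.<⇒≤ (Fin.toℕ<n k))
        (ℕ.≤-trans (ℕ.m≤m+n (suc m) (toℕ i)) (ℕ.≤-reflexive (sym (Fin.toℕ-↑ʳ (suc m) i)))))))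
  Jᴸ≤Mᴸ (inj₂ i) (inj₂ k) i<k = isolatedTwo≤topWithOne λ { refl → ℕ.<-irrefl refl i<k }

  Jᴸ≰Mᴸ : ∀ p → ¬ (Jᴸ p ≤ᵗ Mᴸ p)
  Jᴸ≰Mᴸ (inj₁ i) ≤M with () ← trans (sym (step-≤ {i = i} ℕ.≤-refl))
    (≤topWithZero⁻ i (initialOnes i) ≤M)
  Jᴸ≰Mᴸ (inj₂ i) ≤M with s≤s () ← subst (λ a → toℕ a ℕ.≤ 1) (updateAt-updates (suc i) (λ _ → 0F))
    (≤topWithOne⁻ i (isolatedTwo i) ≤M)

  split : Fin (suc m ℕ.+ m) → Label
  split = splitAt (suc m)

  join-split : ∀ s → join (suc m) m (split s) ≡ s
  join-split = Fin.join-splitAt (suc m) m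

  split-join : ∀ p → split (join (suc m) m p) ≡ p
  split-join = Fin.splitAt-join (suc m) m

  open DecidableOrder.TriangularFamilies (Hoch (suc m)) _≤?ᵗ_ (Jᴸ ∘ split) (Mᴸ ∘ split)
    (λ u v h → Jᴸ-dense u v λ p →
      subst (λ q → Jᴸ q ≤ᵗ u → Jᴸ q ≤ᵗ v) (split-join p) (h (join (suc m) m p)))
    (λ u v h → Mᴸ-dense u v λ p →
      subst (λ q → u ≤ᵗ Mᴸ q → v ≤ᵗ Mᴸ q) (split-join p) (h (join (suc m) m p)))
    (λ {s} {t} s<t → Jᴸ≤Mᴸ (split s) (split t)
      (subst (Fin._< join (suc m) m (split t)) (sym (join-split s))
        (subst (s Fin.<_) (sym (join-split t)) s<t)))
    (Jᴸ≰Mᴸ ∘ split)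
    public

  -- Isomorphism with the explicit graph

  module G = Digraph (explicitGraph (suc m))

  vertex : Label ↔ G.Vertex
  vertex = mk↔ₛ′ to from to∘from from∘to
    where
    to : Label → G.Vertex
    to (inj₁ i) = (1 , suc (toℕ i)) , inj₁ (refl , s≤s z≤n , Fin.toℕ<n i)
    to (inj₂ i) = (2 , suc (suc (toℕ i))) , inj₂ (refl , s≤s (s≤s z≤n) , s≤s (Fin.toℕ<n i))
    from : G.Vertex → Label
    from ((_ , suc t)       , inj₁ (_ , _ , t<n))     = inj₁ (fromℕ< t<n)
    from ((_ , suc (suc t)) , inj₂ (_ , _ , s≤s t<m)) = inj₂ (fromℕ< t<m)
    from ((_ , 1)           , inj₂ (_ , s≤s () , _))
    to∘from : ∀ v → to (from v) ≡ v
    to∘from ((_ , suc t)       , inj₁ (refl , s≤s z≤n , t<n)) = go (fromℕ< t<n) (Fin.toℕ-fromℕ< t<n)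
      where
      -- Replacing `fromℕ< t<n` by any `i` with `toℕ i ≡ t` allows matching on `refl`; then only the
      -- proofs of the upper bound differ.
      go : ∀ i → toℕ i ≡ t → to (inj₁ i) ≡ ((1 , suc t) , inj₁ (refl , s≤s z≤n , t<n))
      go i refl = cong (λ p → (1 , suc t) , inj₁ (refl , s≤s z≤n , p)) (ℕ.≤-irrelevant _ _)
    to∘from ((_ , suc (suc t)) , inj₂ (refl , s≤s (s≤s z≤n) , s≤s t<m)) =
      go (fromℕ< t<m) (Fin.toℕ-fromℕ< t<m)
      where
      go : ∀ i → toℕ i ≡ t → to (inj₂ i) ≡ ((2 , suc (suc t)) , inj₂ (refl , s≤s (s≤s z≤n) , s≤s t<m))
      go i refl = cong (λ p → (2 , suc (suc t)) , inj₂ (refl , s≤s (s≤s z≤n) , s≤s p))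
        (ℕ.≤-irrelevant _ _)
    from∘to : ∀ p → from (to p) ≡ p
    from∘to (inj₁ i) = cong inj₁ (Fin.fromℕ<-toℕ i _)
    from∘to (inj₂ i) = cong inj₂ (Fin.fromℕ<-toℕ i _)

  -- `initialOnes i` fails to be below `topWithZero k` exactly when `k ≤ i`, and `isolatedTwo i`
  -- exactly when `k ≡ suc i`. Comparisons with `topWithOne` fail only between equal labels, so no
  -- edge ends at an `inj₂` label.
  edge : ∀ p q → (p ≢ q × ¬ (Jᴸ p ≤ᵗ Mᴸ q)) ⇔ G.Edge (Inverse.to vertex p) (Inverse.to vertex q)
  edge (inj₁ i) (inj₁ k) = mk⇔
    (λ (i≢k , J≰M) →
      (λ eq → i≢k (cong inj₁ (Fin.toℕ-injective (ℕ.suc-injective (cong proj₂ eq))))) ,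
      inj₂ (refl , refl , s≤s (Fin.≤∧≢⇒<
        (ℕ.≮⇒≥ λ i<k → J≰M (≤topWithZero⁺ k (initialOnes i) (step-> i<k))) λ { refl → i≢k refl })))
    λ { (_ , inj₂ (_ , _ , s≤s k<i)) →
      (λ { refl → ℕ.<-irrefl refl k<i }) ,
      λ J≤M → initialOnes≤⁻ (initialOnes i) (λ _ → ℕ.≤-refl) k (ℕ.<⇒≤ k<i)
        (≤topWithZero⁻ k (initialOnes i) J≤M) }
  edge (inj₁ i) (inj₂ k) = mk⇔
    (λ (_ , J≰M) → contradiction (initialOnes≤topWithOne i k) J≰M)
    λ { (_ , inj₁ (() , _)) ; (_ , inj₂ (_ , () , _)) }
  edge (inj₂ i) (inj₁ k) = mk⇔
    (λ (_ , J≰M) → (λ ()) , inj₁ (refl , refl ,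
      cong (suc ∘ toℕ) (decidable-stable (suc i Fin.≟ k) (J≰M ∘ isolatedTwo≤topWithZero))))
    λ { (_ , inj₁ (_ , _ , eq)) → (λ ()) ,
          subst (λ k → ¬ (isolatedTwo i ≤ᵗ topWithZero k))
            (Fin.toℕ-injective (ℕ.suc-injective eq)) (isolatedTwo≰topWithZero i)
      ; (_ , inj₂ (() , _)) }
  edge (inj₂ i) (inj₂ k) = mk⇔
    (λ (i≢k , J≰M) → contradiction (isolatedTwo≤topWithOne (i≢k ∘ cong inj₂)) J≰M)
    λ { (_ , inj₁ (_ , () , _)) ; (_ , inj₂ (() , _)) }

  galoisGraph≅explicitGraph :
    Extremal.galoisGraph (Hoch (suc m)) galoisLabelling ≅ explicitGraph (suc m)
  galoisGraph≅explicitGraph = record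
    { vertices = ↔-trans Fin.+↔⊎ vertex
    ; edges    = λ s t → mk⇔
        (λ (s≢t , J≰M) → Equivalence.to (edge (split s) (split t))
          ((s≢t ∘ ↔-injective (Fin.+↔⊎ {suc m})) , J≰M))
        (λ e → let split≢ , J≰M = Equivalence.from (edge (split s) (split t)) e
               in (split≢ ∘ cong split) , J≰M)
    }

theorem1p1 : (n : ℕ) .{{_ : NonZero n}} → let open Extremal (Hoch n) in
    (∃[ k ] (IsExtremal k × GaloisLabelling k))
    × (∀ {k} → IsExtremal k → (l : GaloisLabelling k) → galoisGraph l ≅ explicitGraph n)
theorem1p1 (suc m) =
  -- The length is `suc m ℕ.+ m`, that is, 2n - 1 for n = m + 1.
  (_ , isExtremal , galoisLabelling) ,
  λ _ l → ≅-trans (galoisGraph-unique l) galoisGraph≅explicitGraph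
  where open HochIrreducibles m
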